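{- For every integer $t \geq 2$ there exists an integer $d = d(t) \geq 0$ such that every graph with no odd $K_t$ minor is $(6t-9)$-colorable with defect $d$. In other words, the defective chromatic number of the class of graphs with no odd $K_t$ minor is at most $6t-9$.
   Context: All graphs are finite and simple. A graph $G$ is $k$-colorable with defect $d$ if there is a map $\alpha: V(G)\to\{1,\dots,k\}$ such that each color class $\alpha^{ -1}(\{i\})$ induces a subgraph of maximum degree at most $d$. The defective chromatic number of a class $\mathcal C$ of graphs is the minimum $k$ such that for some $d$ all graphs in $\mathcal C$ are $k$-colorable with defect $d$. A graph $G$ contains $H$ as an odd minor if there exist vertex-disjoint subgraphs $\{T_u\}_{u\in V(H)}$ of $G$ which are trees, and a coloring $\alpha:\bigcup_{u\in V(H)}V(T_u)\to\{1,2\}$ such that for every $u\in V(H)$ every edge of $T_u$ has ends of different colors, and for every edge $vw\in E(H)$ there is an edge of $G$ joining $V(T_v)$ and $V(T_w)$ whose two ends have the same color. "No odd $K_t$ minor" means $G$ does not contain the complete graph $K_t$ as an odd minor. -}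

module Defs where

open import Data.Nat using (ℕ; _≤_)
open import Data.Fin using (Fin; _≟_)
open import Data.Bool using (Bool; true; false; not; _∧_)
open import Data.Maybe using (Maybe; just)
open import Data.List using (List; []; _∷_; _∷ʳ_; length; filterᵇ; allFin)
open import Data.List.Relation.Unary.Linked using (Linked)
open import Data.List.Relation.Unary.Unique.Propositional using (Unique)
open import Data.Product using (Σ; ∃; ∃₂; _×_)
open import Relation.Binary.PropositionalEquality using (_≡_; _≢_)
open import Relation.Nullary using (¬_)
open import Relation.Nullary.Decidable using (⌊_⌋)

record Graph : Set where
  field
    n      : ℕ
    adj    : Fin n → Fin n → Bool
    adj-sym    : ∀ x y → adj x y ≡ adj y x
    adj-irrefl : ∀ x → adj x x ≡ false
open Graph public

complete : ℕ → Graph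
complete t = record
  { n = t
  ; adj = λ i j → not ⌊ i ≟ j ⌋
  ; adj-sym = symK
  ; adj-irrefl = irrK
  }
  where
  open import Data.Empty using (⊥-elim)
  open import Relation.Binary.PropositionalEquality using (refl) renaming (sym to ≡-sym)
  open import Relation.Nullary using (yes; no)
  symK : ∀ (i j : Fin t) → not ⌊ i ≟ j ⌋ ≡ not ⌊ j ≟ i ⌋
  symK i j with i ≟ j | j ≟ i
  ... | yes _ | yes _ = refl
  ... | no _  | no _  = refl
  ... | yes p | no q  = ⊥-elim (q (≡-sym p))
  ... | no p  | yes q = ⊥-elim (p (≡-sym q))
  irrK : ∀ (i : Fin t) → not ⌊ i ≟ i ⌋ ≡ false
  irrK i with i ≟ i
  ... | yes _ = refl
  ... | no p  = ⊥-elim (p refl)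

sameColourDegree : (G : Graph) {k : ℕ} → (Fin (n G) → Fin k) → Fin (n G) → ℕ
sameColourDegree G α v =
  length (filterᵇ (λ u → adj G v u ∧ ⌊ α u ≟ α v ⌋) (allFin (n G)))

DefectColourable : Graph → ℕ → ℕ → Set
DefectColourable G k d =
  Σ (Fin (n G) → Fin k) λ α → ∀ v → sameColourDegree G α v ≤ d

data Walk {n : ℕ} (E : Fin n → Fin n → Bool) : Fin n → Fin n → Set where
  here : ∀ x → Walk E x x
  step : ∀ {x y z} → E x y ≡ true → Walk E y z → Walk E x z

HasCycle : {n : ℕ} → (Fin n → Fin n → Bool) → Set
HasCycle E = ∃₂ λ x xs →
  2 ≤ length xs × Unique (x ∷ xs) × Linked (λ a b → E a b ≡ true) (x ∷ xs ∷ʳ x)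

IsTreeSubgraph : (G : Graph) → (Fin (n G) → Set) → (Fin (n G) → Fin (n G) → Bool) → Set
IsTreeSubgraph G V E =
    (∀ x y → E x y ≡ true → adj G x y ≡ true)
  × (∀ x y → E x y ≡ true → V x × V y)
  × (∀ x y → E x y ≡ E y x)
  × (∃ λ x → V x)
  × (∀ x y → V x → V y → Walk E x y)
  × ¬ HasCycle E

-- G contains H as an odd minor.  Vertex-disjointness of the trees T_u is
-- encoded by a single map  branch : V(G) → Maybe V(H)  with
-- V(T_u) = {x | branch x ≡ just u}; the 2-colouring is col.
record OddMinor (H G : Graph) : Set where
  field
    branch  : Fin (n G) → Maybe (Fin (n H))
    treeE   : Fin (n H) → Fin (n G) → Fin (n G) → Bool
    isTree  : ∀ u → IsTreeSubgraph G (λ x → branch x ≡ just u) (treeE u)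
    col     : Fin (n G) → Bool
    bichrom : ∀ u x y → treeE u x y ≡ true → col x ≢ col y
    edges   : ∀ v w → adj H v w ≡ true →
              ∃₂ λ x y → branch x ≡ just v × branch y ≡ just w
                        × adj G x y ≡ true × col x ≡ col y

{-# OPTIONS --safe #-}

-- Already 2(t − 1) colours suffice (an idea of Steiner, after van den Heuvel and
-- Wood).  Trees are split off one at a time, each with a proper 2-colouring of
-- its own and one of t − 1 classes.  In a component C of the uncoloured
-- graph take the union of shortest paths from a root to one neighbour of every
-- earlier tree adjacent to C, coloured by parity of the distance: on each level
-- there is at most one vertex per path, so few neighbours share a colour.  Then
-- absorb, as leaves, vertices of C whose neighbours in the tree all have the
-- same colour.  When this stops, every vertex of C left over and adjacent to the
-- tree sees both of its colours, so every later tree touching it has a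
-- monochromatic edge to it.  Hence the earlier trees adjacent to C, together
-- with the new one, form an odd clique minor; there are fewer than t of them,
-- and some class is free for the new tree.
module Submission where

open import Defs
open import Data.Bool as Bool using (Bool; true; false; not; _∧_; T?)
import Data.Bool.Properties as Bool
open import Data.Empty using (⊥-elim)
open import Data.Fin using (Fin; zero; suc; toℕ; opposite; _≟_; inject≤; combine)
import Data.Fin.Properties as Fin
open import Data.List using (List; []; _∷_; _∷ʳ_; length; lookup; map; filter; allFin)
open import Data.List.Membership.Propositional using (_∈_; _∉_)
open import Data.List.Membership.Propositional.Properties using (∈-allFin; ∈-lookup; ∈-filter⁺; ∈-filter⁻; ∈-map⁺)
open import Data.List.Properties using (length-map; length-tabulate)
open import Data.List.Relation.Unary.All as All using (All; []; _∷_)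
import Data.List.Relation.Unary.All.Properties as All
open import Data.List.Relation.Unary.AllPairs as AllPairs using (AllPairs; []; _∷_)
import Data.List.Relation.Unary.AllPairs.Properties as AllPairs
open import Data.List.Relation.Unary.Any as Any using (Any; here; there)
import Data.List.Relation.Unary.Any.Properties as Any
open import Data.List.Relation.Unary.Linked using (Linked; _∷_)
open import Data.List.Relation.Unary.Unique.Propositional using (Unique)
import Data.List.Relation.Unary.Unique.Propositional.Properties as Unique
open import Data.Maybe using (Maybe; just; nothing)
open import Data.Maybe.Properties using (just-injective)
open import Data.Unit using (⊤; tt)
open import Data.Nat using (ℕ; zero; suc; _+_; _*_; _∸_; _≤_; _<_; z≤n; s≤s; s≤s⁻¹; _≤?_)
import Data.Nat.Properties as ℕ
open import Data.Nat.Solver using (module +-*-Solver)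
open import Data.Product using (∃; ∃₂; _×_; _,_; proj₁; proj₂)
open import Data.Sum using (_⊎_; inj₁; inj₂; [_,_]′; swap)
open import Data.Vec.Functional using (updateAt)
open import Data.Vec.Functional.Properties using (updateAt-updates; updateAt-minimal)
open import Function using (_∘_; const)
open import Relation.Binary.Construct.Closure.ReflexiveTransitive as Star using (Star; ε; _◅_; _◅◅_)
open import Relation.Binary.PropositionalEquality using (_≡_; _≢_; refl; sym; trans; cong; subst; ≢-sym; module ≡-Reasoning)
open import Relation.Nullary using (¬_; Dec; yes; no)
open import Relation.Nullary.Decidable using (⌊_⌋; _×-dec_; _⊎-dec_; ¬?; map′; decidable-stable)
open import Relation.Unary using (Decidable)

-- Finite lists: counting, pairs of entries, indices of colour pairs.

remove : ∀ {A : Set} {y : A} {xs} → y ∈ xs →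
  ∃ λ ys → length xs ≡ suc (length ys) × (∀ {x} → x ∈ xs → x ≢ y → x ∈ ys)
remove {xs = _ ∷ xs} (here refl) = xs , refl ,
  λ { (here eq) x≢y → ⊥-elim (x≢y eq) ; (there x∈) _ → x∈ }
remove {xs = z ∷ _} (there y∈) with remove y∈
... | ys , eq , keep = z ∷ ys , cong suc eq ,
  λ { (here e) _ → here e ; (there x∈) x≢y → there (keep x∈ x≢y) }

unique-⊆⇒length≤ : ∀ {A : Set} {xs ys : List A} →
  Unique xs → (∀ {x} → x ∈ xs → x ∈ ys) → length xs ≤ length ys
unique-⊆⇒length≤ [] _ = z≤n
unique-⊆⇒length≤ {xs = x ∷ xs} (x∉ ∷ uniq) sub with remove (sub (here refl))
... | zs , eq , keep rewrite eq =
  s≤s (unique-⊆⇒length≤ uniq λ z∈ → keep (sub (there z∈)) (≢-sym (All.lookup x∉ z∈)))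

-- Otherwise the repetition-free list of all `k` colours would be contained in `cs`.
fresh : ∀ {k} (cs : List (Fin k)) → length cs < k → ∃ λ c → c ∉ cs
fresh {k} cs short with Fin.any? (λ c → ¬? (Any.any? (c ≟_) cs))
... | yes found = found
... | no none = ⊥-elim (ℕ.<⇒≱ short
  (subst (_≤ length cs) (length-tabulate {n = k} (λ i → i))
    (unique-⊆⇒length≤ (Unique.allFin⁺ k) λ {c} _ →
      decidable-stable (Any.any? (c ≟_) cs) λ c∉ → none (c , c∉))))

AllPairs-lookup : ∀ {a r} {A : Set a} {R : A → A → Set r} {xs} → AllPairs R xs →
  (∀ {x y} → R x y → R y x) → ∀ i j → i ≢ j → R (lookup xs i) (lookup xs j)
AllPairs-lookup (_ ∷ _)   _    zero    zero    i≢j = ⊥-elim (i≢j refl)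
AllPairs-lookup {xs = _ ∷ xs} (px ∷ _)  _    zero    (suc j) _ = All.lookup px (∈-lookup j)
AllPairs-lookup {xs = _ ∷ xs} (px ∷ _)  sym′ (suc i) zero    _ = sym′ (All.lookup px (∈-lookup i))
AllPairs-lookup (_ ∷ pxs) sym′ (suc i) (suc j) i≢j =
  AllPairs-lookup pxs sym′ i j (i≢j ∘ cong suc)

AllPairs-map-with-All : ∀ {a p r s} {A : Set a} {P : A → Set p} {R : A → A → Set r} {S : A → A → Set s} →
  (∀ {x y} → P x → P y → R x y → S x y) → ∀ {xs} → All P xs → AllPairs R xs → AllPairs S xs
AllPairs-map-with-All f []         []         = []
AllPairs-map-with-All f (px ∷ pxs) (rx ∷ rxs) =
  All.zipWith (λ (py , rxy) → f px py rxy) (pxs , rx) ∷ AllPairs-map-with-All f pxs rxs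

pairIndex : ∀ {k} → Fin k × Bool → Fin (k * 2)
pairIndex (c , false) = combine c zero
pairIndex (c , true)  = combine c (suc zero)

pairIndex-injective : ∀ {k} (p q : Fin k × Bool) → pairIndex p ≡ pairIndex q → p ≡ q
pairIndex-injective (c , false) (d , false) eq = cong (_, false) (Fin.combine-injectiveˡ c _ d _ eq)
pairIndex-injective (c , true)  (d , true)  eq = cong (_, true) (Fin.combine-injectiveˡ c _ d _ eq)
pairIndex-injective (c , false) (d , true)  eq with () ← Fin.combine-injectiveʳ c zero d (suc zero) eq
pairIndex-injective (c , true)  (d , false) eq with () ← Fin.combine-injectiveʳ c (suc zero) d zero eq

-- Rooted forests have no cycles.

-- A closed walk that never backtracks in a rooted forest would have to climb
-- towards the root and then descend, so it would leave and re-enter its first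
-- vertex through the same parent.
module _ {m} (E : Fin m → Fin m → Bool) (Up : Fin m → Fin m → Set) (rk : Fin m → ℕ)
  (orient : ∀ {a b} → E a b ≡ true → Up a b ⊎ Up b a)
  (Up-rk : ∀ {a b} → Up a b → rk b < rk a)
  (Up-functional : ∀ {a b c} → Up a b → Up a c → b ≡ c) where

  private
    last : Fin m → List (Fin m) → Fin m
    last b []      = b
    last _ (c ∷ l) = last c l

    last-∈ : ∀ b l → last b l ∈ b ∷ l
    last-∈ b []      = here refl
    last-∈ _ (c ∷ l) = there (last-∈ c l)

    Edges : List (Fin m) → Set
    Edges = Linked (λ a b → E a b ≡ true)

  private
    -- After one step away from the root the walk cannot turn: the only way up from `b` is back to
    -- `a`, which does not recur. So ranks rise until `x` is entered from its parent.
    descend : ∀ a b l x → Edges (b ∷ l ∷ʳ x) → Up b a → Unique (a ∷ b ∷ l) → All (x ≢_) (a ∷ b ∷ l) →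
      rk a < rk x × Up x (last b l)
    descend a b [] x (e ∷ _) b↑a _ (x≢a ∷ _) with orient e
    ... | inj₁ b↑x = ⊥-elim (x≢a (Up-functional b↑x b↑a))
    ... | inj₂ x↑b = ℕ.<-trans (Up-rk b↑a) (Up-rk x↑b) , x↑b
    descend a b (c ∷ l) x (e ∷ es) b↑a ((_ ∷ a≢c ∷ _) ∷ uniq) (_ ∷ x∉) with orient e
    ... | inj₁ b↑c = ⊥-elim (a≢c (Up-functional b↑a b↑c))
    ... | inj₂ c↑b with descend b c l x es c↑b uniq x∉
    ...   | b<x , x↑ = ℕ.<-trans (Up-rk b↑a) b<x , x↑

    -- A walk that starts upwards either climbs all the way, so that `x` has smaller rank than `a`,
    -- or turns down once and then enters `x` from its parent.
    climb : ∀ a b l x → Edges (b ∷ l ∷ʳ x) → Up a b → Unique (b ∷ l) → All (x ≢_) (b ∷ l) →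
      rk x < rk a ⊎ Up x (last b l)
    climb a b [] x (e ∷ _) a↑b _ _ with orient e
    ... | inj₁ b↑x = inj₁ (ℕ.<-trans (Up-rk b↑x) (Up-rk a↑b))
    ... | inj₂ x↑b = inj₂ x↑b
    climb a b (c ∷ l) x (e ∷ es) a↑b uniq x∉ with orient e
    ... | inj₂ c↑b = inj₂ (proj₂ (descend b c l x es c↑b uniq x∉))
    ... | inj₁ b↑c with climb b c l x es b↑c (AllPairs.tail uniq) (All.tail x∉)
    ...   | inj₁ x<b = inj₁ (ℕ.<-trans x<b (Up-rk a↑b))
    ...   | inj₂ x↑ = inj₂ x↑

  acyclic : ¬ HasCycle E
  acyclic (x , y ∷ [] , s≤s () , _)
  acyclic (x , y ∷ z ∷ l , _ , (x∉@(_ ∷ x≢z ∷ _)) ∷ uniq , e ∷ es@(e′ ∷ es′)) with orient e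
  ... | inj₁ x↑y with climb x y (z ∷ l) x es x↑y uniq x∉
  ...   | inj₁ x<x = ℕ.<-irrefl refl x<x
  ...   | inj₂ x↑ = All.lookup (AllPairs.head uniq)
                      (subst (_∈ z ∷ l) (Up-functional x↑ x↑y) (last-∈ z l)) refl
  -- Here `x` is the parent of `y`, so the walk has to go on downwards and would return to `x` at a
  -- rank above that of `y`.
  acyclic (x , y ∷ z ∷ l , _ , (x∉@(_ ∷ x≢z ∷ _)) ∷ uniq , e ∷ es@(e′ ∷ es′)) | inj₂ y↑x with orient e′
  ... | inj₁ y↑z = x≢z (Up-functional y↑x y↑z)
  ... | inj₂ z↑y = ℕ.<-asym (Up-rk y↑x) (proj₁ (descend y z l x es′ z↑y uniq x∉))

-- Rooted two-coloured trees and the odd clique minors built from them.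

module _ (G : Graph) where

  private
    V : Set
    V = Fin (n G)

  infix 4 _~_
  _~_ : V → V → Set
  x ~ y = adj G x y ≡ true

  _~?_ : ∀ x y → Dec (x ~ y)
  x ~? y = adj G x y Bool.≟ true

  ~-sym : ∀ {x y} → x ~ y → y ~ x
  ~-sym {x} {y} = trans (adj-sym G y x)

  ~-irrefl : ∀ {x} → ¬ x ~ x
  ~-irrefl {x} x~x with trans (sym x~x) (adj-irrefl G x)
  ... | ()

  -- A tree is given by parent pointers along which `rk` drops; this yields both connectedness and
  -- acyclicity.
  record Tree : Set₁ where
    field
      _∋_    : V → Set
      _∋?_   : Decidable _∋_
      root   : V
      root∈  : _∋_ root
      col    : V → Bool
      par    : V → V
      rk     : V → ℕ
      parent : ∀ {x} → _∋_ x → x ≢ root →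
        _∋_ (par x) × par x ~ x × rk (par x) < rk x × col (par x) ≢ col x

  open Tree

  Disjoint : Tree → Tree → Set
  Disjoint P Q = ∀ {x} → P ∋ x → ¬ Q ∋ x

  OddAdj : Tree → Tree → Set
  OddAdj P Q = ∃₂ λ x y → P ∋ x × Q ∋ y × x ~ y × col P x ≡ col Q y

  OddAdj-sym : ∀ {P Q} → OddAdj P Q → OddAdj Q P
  OddAdj-sym (x , y , x∈ , y∈ , x~y , eq) = y , x , y∈ , x∈ , ~-sym x~y , sym eq

  module TreeEdges (T : Tree) where

    Up : V → V → Set
    Up x y = T ∋ x × x ≢ root T × y ≡ par T x

    edge? : ∀ x y → Dec (Up x y ⊎ Up y x)
    edge? x y = up? x y ⊎-dec up? y x
      where
      up? : ∀ x y → Dec (Up x y)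
      up? x y = (T ∋? x) ×-dec ¬? (x ≟ root T) ×-dec (y ≟ par T x)

    E : V → V → Bool
    E x y = ⌊ edge? x y ⌋

    E⇒Up : ∀ {x y} → E x y ≡ true → Up x y ⊎ Up y x
    E⇒Up {x} {y} e with edge? x y
    ... | yes u = u

    Up⇒E : ∀ {x y} → Up x y ⊎ Up y x → E x y ≡ true
    Up⇒E {x} {y} u with edge? x y
    ... | yes _ = refl
    ... | no ¬u = ⊥-elim (¬u u)

    E-sym : ∀ x y → E x y ≡ E y x
    E-sym x y with edge? x y | edge? y x
    ... | yes _ | yes _ = refl
    ... | no _  | no _  = refl
    ... | yes u | no ¬u = ⊥-elim (¬u (swap u))
    ... | no ¬u | yes u = ⊥-elim (¬u (swap u))

    up-step : ∀ {x y} → Up x y → T ∋ y × y ~ x × rk T y < rk T x × col T y ≢ col T x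
    up-step (x∈ , x≢r , refl) = parent T x∈ x≢r

    E-col : ∀ {x y} → E x y ≡ true → col T x ≢ col T y
    E-col e with E⇒Up e
    ... | inj₁ u = ≢-sym (proj₂ (proj₂ (proj₂ (up-step u))))
    ... | inj₂ u = proj₂ (proj₂ (proj₂ (up-step u)))

    E-adj : ∀ x y → E x y ≡ true → x ~ y
    E-adj x y e with E⇒Up e
    ... | inj₁ u = ~-sym (proj₁ (proj₂ (up-step u)))
    ... | inj₂ u = proj₁ (proj₂ (up-step u))

    E-∋ : ∀ x y → E x y ≡ true → T ∋ x × T ∋ y
    E-∋ x y e with E⇒Up e
    ... | inj₁ u = proj₁ u , proj₁ (up-step u)
    ... | inj₂ u = proj₁ (up-step u) , proj₁ u

    E-acyclic : ¬ HasCycle E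
    E-acyclic = acyclic E Up (rk T) E⇒Up (λ u → proj₁ (proj₂ (proj₂ (up-step u))))
      λ { (_ , _ , refl) (_ , _ , refl) → refl }

    walk-++ : ∀ {x y z} → Walk E x y → Walk E y z → Walk E x z
    walk-++ (here _)   w = w
    walk-++ (step e v) w = step e (walk-++ v w)

    walk-reverse : ∀ {x y} → Walk E x y → Walk E y x
    walk-reverse (here x) = here x
    walk-reverse (step {x} {y} e w) =
      walk-++ (walk-reverse w) (step (trans (E-sym y x) e) (here x))

    walk-to-root : ∀ m x → T ∋ x → rk T x < m → Walk E x (root T)
    walk-to-root (suc m) x x∈ x<m with x ≟ root T
    ... | yes refl = here x
    ... | no x≢r with parent T x∈ x≢r
    ...   | p∈ , _ , p<x , _ = step (Up⇒E (inj₁ (x∈ , x≢r , refl)))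
            (walk-to-root m (par T x) p∈ (ℕ.<-≤-trans p<x (s≤s⁻¹ x<m)))

    connected : ∀ x y → T ∋ x → T ∋ y → Walk E x y
    connected x y x∈ y∈ = walk-++ (to-root x x∈) (walk-reverse (to-root y y∈))
      where
      to-root : ∀ x → T ∋ x → Walk E x (root T)
      to-root x x∈ = walk-to-root (suc (rk T x)) x x∈ ℕ.≤-refl

  -- By disjointness a vertex has at most one owner, so the separate colourings of the trees glue to
  -- a single one; vertices without owner get the colour `false`.
  oddMinor : ∀ {t} (Ts : Fin t → Tree) →
    (∀ {i j} → i ≢ j → Disjoint (Ts i) (Ts j)) → (∀ {i j} → i ≢ j → OddAdj (Ts i) (Ts j)) →
    OddMinor (complete t) G
  oddMinor {t} Ts disj odd = record
    { branch  = λ x → branchOf (owner? x)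
    ; treeE   = λ i → E (Ts i)
    ; isTree  = λ i → E-adj (Ts i)
        , (λ x y e → let x∈ , y∈ = E-∋ (Ts i) x y e in ∋⇒branch x∈ , ∋⇒branch y∈)
        , E-sym (Ts i)
        , (root (Ts i) , ∋⇒branch (root∈ (Ts i)))
        , (λ x y bx by → connected (Ts i) x y (branch⇒∋ bx) (branch⇒∋ by))
        , E-acyclic (Ts i)
    ; col     = λ x → colOf (owner? x)
    ; bichrom = λ i x y e eq → let x∈ , y∈ = E-∋ (Ts i) x y e in
        E-col (Ts i) e (trans (sym (∋⇒col x∈)) (trans eq (∋⇒col y∈)))
    ; edges   = λ v w vw → let x , y , x∈ , y∈ , x~y , eq = odd (distinct v w vw) in
        x , y , ∋⇒branch x∈ , ∋⇒branch y∈ , x~y , trans (∋⇒col x∈) (trans eq (sym (∋⇒col y∈)))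
    }
    where
    open TreeEdges
    Owner : V → Set
    Owner x = ∃ λ i → Ts i ∋ x
    owner? : ∀ x → Dec (Owner x)
    owner? x = Fin.any? λ i → Ts i ∋? x
    branchOf : ∀ {x} → Dec (Owner x) → Maybe (Fin t)
    branchOf (yes (i , _)) = just i
    branchOf (no _)        = nothing
    colOf : ∀ {x} → Dec (Owner x) → Bool
    colOf {x} (yes (i , _)) = col (Ts i) x
    colOf     (no _)        = false
    unique-owner : ∀ {i j x} → Ts i ∋ x → Ts j ∋ x → i ≡ j
    unique-owner {i} {j} x∈i x∈j = decidable-stable (i ≟ j) λ i≢j → disj i≢j x∈i x∈j
    ∋⇒branch : ∀ {i x} → Ts i ∋ x → branchOf (owner? x) ≡ just i
    ∋⇒branch {i} {x} x∈ with owner? x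
    ... | yes (j , x∈j) = cong just (unique-owner x∈j x∈)
    ... | no none       = ⊥-elim (none (i , x∈))
    branch⇒∋ : ∀ {i x} → branchOf (owner? x) ≡ just i → Ts i ∋ x
    branch⇒∋ {x = x} eq with owner? x
    ... | yes (j , x∈j) = subst (λ i → Ts i ∋ x) (just-injective eq) x∈j
    ∋⇒col : ∀ {i x} → Ts i ∋ x → colOf (owner? x) ≡ col (Ts i) x
    ∋⇒col {i} {x} x∈ with owner? x
    ... | yes (j , x∈j) = cong (λ i → col (Ts i) x) (unique-owner x∈j x∈)
    ... | no none       = ⊥-elim (none (i , x∈))
    distinct : ∀ v w → adj (complete t) v w ≡ true → v ≢ w
    distinct v .v eq refl with trans (sym eq) (adj-irrefl (complete t) v)
    ... | ()

  -- Growing a tree by absorbing leaves.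

  Att : Tree → V → Set
  Att P y = ∃ λ x → P ∋ x × x ~ y

  att? : ∀ P y → Dec (Att P y)
  att? P y = Fin.any? λ x → (P ∋? x) ×-dec (x ~? y)

  SeesBoth : Tree → V → Set
  SeesBoth P y = ∀ b → ∃ λ x → P ∋ x × x ~ y × col P x ≡ b

  Mono : Tree → V → V → Set
  Mono P x u = P ∋ u × x ~ u × col P u ≡ col P x

  -- A covering list in place of a count: it may contain repetitions and further vertices, so no
  -- exact neighbourhood has to be computed.
  Defect : ℕ → Tree → Set
  Defect d P = ∀ {x} → P ∋ x → ∃ λ L → length L ≤ d × (∀ {u} → Mono P x u → u ∈ L)

  module Leaf (T : Tree) {y p : V} (y∉ : ¬ T ∋ y) (p∈ : T ∋ p) (p~y : p ~ y) where

    private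
      extend : ∀ {A : Set} → (V → A) → A → V → A
      extend f a = updateAt f y (const a)

      extend-new : ∀ {A : Set} (f : V → A) a → extend f a y ≡ a
      extend-new f a = updateAt-updates y f

      extend-old : ∀ {A : Set} (f : V → A) a {x} → T ∋ x → extend f a x ≡ f x
      extend-old f a {x} x∈ = updateAt-minimal x y f λ { refl → y∉ x∈ }

    leaf : Tree
    leaf ._∋_ x = T ∋ x ⊎ x ≡ y
    leaf ._∋?_ x = (T ∋? x) ⊎-dec (x ≟ y)
    leaf .root = root T
    leaf .root∈ = inj₁ (root∈ T)
    leaf .col = extend (col T) (not (col T p))
    leaf .par = extend (par T) p
    leaf .rk = extend (rk T) (suc (rk T p))
    leaf .parent (inj₂ refl) _
      rewrite extend-new (par T) p | extend-new (rk T) (suc (rk T p)) | extend-new (col T) (not (col T p))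
        | extend-old (rk T) (suc (rk T p)) p∈ | extend-old (col T) (not (col T p)) p∈
      = inj₁ p∈ , p~y , ℕ.≤-refl , Bool.not-¬ refl
    leaf .parent (inj₁ x∈) x≢r with parent T x∈ x≢r
    ... | q∈ , q~x , q<x , colour
      rewrite extend-old (par T) p x∈
        | extend-old (rk T) (suc (rk T p)) x∈ | extend-old (col T) (not (col T p)) x∈
        | extend-old (rk T) (suc (rk T p)) q∈ | extend-old (col T) (not (col T p)) q∈
      = inj₁ q∈ , q~x , q<x , colour

    leaf-col-old : ∀ {x} → T ∋ x → col leaf x ≡ col T x
    leaf-col-old = extend-old (col T) _

    leaf-col-new : col leaf y ≡ not (col T p)
    leaf-col-new = extend-new (col T) _

    -- The colour of `y` is opposite to that of all its neighbours in `T`, so `y` lies on no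
    -- monochromatic edge: the old lists still work and `y` gets the empty list.
    leaf-defect : ∀ {d} → (∀ {x} → T ∋ x → x ~ y → col T x ≡ col T p) → Defect d T → Defect d leaf
    leaf-defect same def (inj₁ x∈) with def x∈
    ... | L , short , cover = L , short , λ
      { (inj₁ u∈ , x~u , eq) → cover (u∈ , x~u , trans (sym (leaf-col-old u∈)) (trans eq (leaf-col-old x∈)))
      ; (inj₂ refl , x~y , eq) → ⊥-elim (Bool.not-¬
          (trans (sym (same x∈ x~y)) (trans (sym (leaf-col-old x∈)) (sym eq))) leaf-col-new′) }
      where
      leaf-col-new′ : col T p ≡ not (col leaf y)
      leaf-col-new′ = sym (trans (cong not leaf-col-new) (Bool.not-involutive _))
    leaf-defect same def (inj₂ refl) = [] , z≤n , λ
      { (inj₁ u∈ , y~u , eq) → ⊥-elim (Bool.not-¬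
          (trans (sym (same u∈ (~-sym y~u))) (trans (sym (leaf-col-old u∈)) eq))
          (sym (trans (cong not leaf-col-new) (Bool.not-involutive _))))
      ; (inj₂ refl , y~y , _) → ⊥-elim (~-irrefl y~y) }

  Maximal : (V → Set) → Tree → Set
  Maximal C T = ∀ {y} → C y → ¬ T ∋ y → Att T y → SeesBoth T y

  -- A vertex of `C` is absorbed as a leaf below `p` as long as one has neighbours in `T` of the
  -- colour of `p` only. The list `L` covers what is left of `C` and loses an entry each time, so
  -- the recursion on `l` ends.
  grow : ∀ {d} {C : V → Set} → Decidable C → (T : Tree) → (∀ {x} → T ∋ x → C x) → Defect d T →
    ∀ l (L : List V) → length L ≡ l → (∀ {x} → C x → ¬ T ∋ x → x ∈ L) →
    ∃ λ T′ → (∀ {x} → T ∋ x → T′ ∋ x) × (∀ {x} → T′ ∋ x → C x) × Defect d T′ × Maximal C T′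
  grow {C = C} C? T T⊆C def l L len rest
    with Fin.any? (λ y → C? y ×-dec ¬? (T ∋? y) ×-dec Fin.any? λ p → (T ∋? p) ×-dec (p ~? y) ×-dec
           ¬? (Fin.any? λ x → (T ∋? x) ×-dec (x ~? y) ×-dec (col T x Bool.≟ not (col T p))))
  ... | no none = T , (λ x∈ → x∈) , T⊆C , def , maximal
    where
    maximal : Maximal C T
    maximal {y} yC y∉ (p , p∈ , p~y) b with b Bool.≟ col T p
    ... | yes eq = p , p∈ , p~y , sym eq
    -- If `y` missed the colour opposite to that of `p`, it could still be absorbed.
    ... | no b≢ = decidable-stable (Fin.any? λ x → (T ∋? x) ×-dec (x ~? y) ×-dec (col T x Bool.≟ b))
      λ ¬other → none (y , yC , y∉ , p , p∈ , p~y ,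
        λ (x , x∈ , x~y , eq) → ¬other (x , x∈ , x~y , trans eq (sym (Bool.¬-not b≢))))
  ... | yes (y , yC , y∉ , p , p∈ , p~y , ¬other) with remove (rest yC y∉)
  ...   | L′ , len′ , keep with l | trans (sym len) len′
  ...     | suc l′ | eq with grow C? leaf [ T⊆C , (λ { refl → yC }) ]′ (leaf-defect same def) l′ L′
                (sym (ℕ.suc-injective eq))
                (λ xC x∉ → keep (rest xC (x∉ ∘ inj₁)) (x∉ ∘ inj₂))
    where
    open Leaf T y∉ p∈ p~y
    same : ∀ {x} → T ∋ x → x ~ y → col T x ≡ col T p
    same {x} x∈ x~y = decidable-stable (col T x Bool.≟ col T p)
      λ ≢ → ¬other (x , x∈ , x~y , Bool.¬-not ≢)
  ...       | T′ , T⊆T′ , props = T′ , T⊆T′ ∘ inj₁ , props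

  -- Components of the uncoloured graph and distances in them.

  Edge : (V → Set) → V → V → Set
  Edge R u v = R u × u ~ v × R v

  module Component (R : V → Set) (R? : Decidable R) (r : V) (r∈R : R r) where

    private
      Step : V → V → Set
      Step = Edge R

    C : V → Set
    C = Star Step r

    Step-sym : ∀ {u v} → Step u v → Step v u
    Step-sym (u∈ , u~v , v∈) = v∈ , ~-sym u~v , u∈

    Star⊆R : ∀ {u v} → R u → Star Step u v → R v
    Star⊆R u∈ ε = u∈
    Star⊆R _ ((_ , _ , v∈) ◅ w) = Star⊆R v∈ w

    C⊆R : ∀ {v} → C v → R v
    C⊆R = Star⊆R r∈R

    C-closed : ∀ {u v} → C u → u ~ v → R v → C v
    C-closed u∈ u~v v∈ = u∈ ◅◅ ((C⊆R u∈ , u~v , v∈) ◅ ε)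

    Reach : ℕ → V → Set
    Reach zero    v = v ≡ r
    Reach (suc m) v = ∃ λ u → Reach m u × Step u v

    reach? : ∀ m v → Dec (Reach m v)
    reach? zero    v = v ≟ r
    reach? (suc m) v = Fin.any? λ u → reach? m u ×-dec R? u ×-dec (u ~? v) ×-dec R? v

    Dist : ℕ → V → Set
    Dist m v = Reach m v × (∀ {l} → l < m → ¬ Reach l v)

    Reach⇒C : ∀ m {v} → Reach m v → C v
    Reach⇒C zero    refl           = ε
    Reach⇒C (suc m) (u , u∈ , uv) = Reach⇒C m u∈ ◅◅ (uv ◅ ε)

    Reach-Star : ∀ m {u v} → Reach m u → Star Step u v → ∃ λ l → Reach l v
    Reach-Star m u∈ ε        = m , u∈
    Reach-Star m u∈ (uv ◅ w) = Reach-Star (suc m) (_ , u∈ , uv) w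

    least : ∀ m {v} → Reach m v → ∃ λ l → Dist l v
    least m {v} = go m (ℕ.≤-refl)
      where
      go : ∀ b {m} → m ≤ b → Reach m v → ∃ λ l → Dist l v
      go b {m} m≤b vm with ℕ.anyUpTo? (λ l → reach? l v) m
      go b       {m} m≤b vm | no none = m , vm , λ l<m vl → none (_ , l<m , vl)
      go zero    z≤n vm | yes (l , () , vl)
      go (suc b) m≤b vm | yes (l , l<m , vl) = go b (s≤s⁻¹ (ℕ.<-≤-trans l<m m≤b)) vl

    abstract
      C⇒Dist : ∀ {v} → C v → ∃ λ m → Dist m v
      C⇒Dist w = let m , vm = Reach-Star zero refl w in least m vm

    Dist-unique : ∀ {l m v} → Dist l v → Dist m v → l ≡ m
    Dist-unique (vl , l-min) (vm , m-min) =
      ℕ.≤-antisym (ℕ.≮⇒≥ λ m<l → l-min m<l vm) (ℕ.≮⇒≥ λ l<m → m-min l<m vl)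

    Dist-parent : ∀ {m v} → Dist (suc m) v → ∃ λ u → Dist m u × u ~ v
    Dist-parent ((u , um , uv@(_ , u~v , _)) , min) =
      u , (um , λ l<m ul → min (s≤s l<m) (u , ul , uv)) , u~v

    -- A shortest walk to `v` passes through every distance from `m` down to zero; index `zero`
    -- belongs to `v` itself, hence `opposite`.
    Dist-prefix : ∀ m {v} → Dist m v → (i : Fin (suc m)) → ∃ λ u → Dist (toℕ (opposite i)) u
    Dist-prefix m       {v} vm zero    = v , subst (λ l → Dist l v) (sym (Fin.toℕ-fromℕ m)) vm
    Dist-prefix (suc m) vm (suc i) =
      subst (λ l → ∃ (Dist l)) (sym (Fin.toℕ-inject₁ (opposite i)))
        (Dist-prefix m (proj₁ (proj₂ (Dist-parent vm))) i)

    -- Vertices at the distances from zero to `m` are distinct, so there is room for at most `n G`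
    -- distances. This bounds the search by which `C?` decides membership.
    Dist<n : ∀ {m v} → Dist m v → m < n G
    Dist<n {m} vm = Fin.injective⇒≤ {f = proj₁ ∘ at} λ {i} {j} eq →
      trans (sym (Fin.opposite-involutive i)) (trans (cong opposite (Fin.toℕ-injective
        (Dist-unique (proj₂ (at i)) (subst (Dist _) (sym eq) (proj₂ (at j))))))
        (Fin.opposite-involutive j))
      where
      at = Dist-prefix m vm

    abstract
      C? : Decidable C
      C? v = map′ (λ (m , _ , vm) → Reach⇒C m vm)
                  (λ w → let m , vm = C⇒Dist w in m , Dist<n vm , proj₁ vm)
                  (ℕ.anyUpTo? (λ m → reach? m v) (n G))

    dist : V → ℕ
    dist v = distOf (C? v)
      where
      distOf : Dec (C v) → ℕ
      distOf (yes w) = proj₁ (C⇒Dist w)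
      distOf (no _)  = zero

    dist-spec : ∀ {v} → C v → Dist (dist v) v
    dist-spec {v} w with C? v
    ... | yes w′ = proj₂ (C⇒Dist w′)
    ... | no  ¬w = ⊥-elim (¬w w)

    prev : ∀ m {v} → Dist m v → V
    -- A default at the root, which is the only vertex at distance zero.
    prev zero    {v} _ = v
    prev (suc m) vm    = proj₁ (Dist-parent vm)

    bfsPar : V → V
    bfsPar v = parOf (C? v)
      where
      parOf : Dec (C v) → V
      parOf (yes w) = let m , vm = C⇒Dist w in prev m vm
      parOf (no _)  = v

    bfsPar-spec : ∀ {v} → C v → v ≢ r →
      C (bfsPar v) × bfsPar v ~ v × dist v ≡ suc (dist (bfsPar v))
    bfsPar-spec {v} w v≢r with C? v
    ... | no ¬w = ⊥-elim (¬w w)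
    ... | yes w′ = let m , vm = C⇒Dist w′ in spec m vm
      where
      spec : ∀ m (vm : Dist m v) → C (prev m vm) × prev m vm ~ v × m ≡ suc (dist (prev m vm))
      spec zero    (v≡r , _) = ⊥-elim (v≢r v≡r)
      spec (suc m) vm = uC , u~v , cong suc (Dist-unique um (dist-spec uC))
        where
        um = proj₁ (proj₂ (Dist-parent vm))
        u~v = proj₂ (proj₂ (Dist-parent vm))
        uC = Reach⇒C m (proj₁ um)

    dist-adj : ∀ {u v} → C u → C v → u ~ v → dist v ≤ suc (dist u)
    dist-adj u∈ v∈ u~v = ℕ.≮⇒≥ λ lt → proj₂ (dist-spec v∈) lt
      (_ , proj₁ (dist-spec u∈) , C⊆R u∈ , u~v , C⊆R v∈)

    ancestor : ℕ → V → V
    ancestor zero    v = v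
    ancestor (suc i) v = bfsPar (ancestor i v)

    parity : ℕ → Bool
    parity zero    = false
    parity (suc m) = not (parity m)

    -- The union of shortest paths to the terminals.

    module Hull (L : List V) (r∈L : r ∈ L) (L⊆C : ∀ {v} → v ∈ L → C v) where

      -- `x` lies on the path of parents from `v` to `r`. The levels fix the number of steps, so `v`
      -- contributes at most one vertex per level.
      Below : V → V → Set
      Below x v = dist x ≤ dist v × x ≡ ancestor (dist v ∸ dist x) v

      hull : Tree
      hull ._∋_ x = C x × Any (Below x) L
      hull ._∋?_ x = C? x ×-dec
        Any.any? (λ v → (dist x ≤? dist v) ×-dec (x ≟ ancestor (dist v ∸ dist x) v)) L
      hull .root = r
      hull .root∈ = ε ,
        Any.map (λ { refl → ℕ.≤-refl , cong (λ i → ancestor i r) (sym (ℕ.n∸n≡0 (dist r))) }) r∈L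
      hull .col = parity ∘ dist
      hull .par = bfsPar
      hull .rk = dist
      hull .parent {x} (x∈ , below) x≢r with bfsPar-spec x∈ x≢r
      ... | p∈ , p~x , eq = (p∈ , Any.map up below) , p~x , ℕ.≤-reflexive (sym eq) ,
        λ same → Bool.not-¬ (sym same) (cong parity eq)
        where
        open ≡-Reasoning
        d = dist (bfsPar x)
        -- The parent of `x` lies one step further along the same path; it is strictly nearer to `r`
        -- than `v`, so truncated subtraction loses nothing.
        up : ∀ {v} → Below x v → Below (bfsPar x) v
        up {v} (x≤v , x≡) = ℕ.≤-trans (ℕ.n≤1+n _) d<v , (begin
          bfsPar x                                  ≡⟨ cong bfsPar x≡ ⟩
          ancestor (suc (dist v ∸ dist x)) v        ≡⟨ cong (λ e → ancestor (suc (dist v ∸ e)) v) eq ⟩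
          ancestor (suc (dist v ∸ suc d)) v         ≡⟨ cong (λ i → ancestor i v) (ℕ.+-∸-assoc 1 d<v) ⟨
          ancestor (dist v ∸ d) v                   ∎)
          where
          d<v : d < dist v
          d<v = subst (_≤ dist v) eq x≤v

      L⊆hull : ∀ {v} → v ∈ L → hull ∋ v
      L⊆hull {v} v∈ = L⊆C v∈ ,
        Any.map (λ { refl → ℕ.≤-refl , cong (λ i → ancestor i v) (sym (ℕ.n∸n≡0 (dist v))) }) v∈

      -- Adjacent vertices of equal parity lie on the same level, and each
      -- terminal contributes a single vertex per level.
      hull-defect : Defect (length L) hull
      hull-defect {x} (x∈ , _) = map level L , ℕ.≤-reflexive (length-map level L) ,
        λ ((u∈ , below) , x~u , eq) → Any.map⁺ (Any.map
          (λ { {v} (_ , u≡) → trans u≡ (cong (λ e → ancestor (dist v ∸ e) v)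
                 (same-level (dist-adj x∈ u∈ x~u) (dist-adj u∈ x∈ (~-sym x~u)) eq)) }) below)
        where
        level : V → V
        level v = ancestor (dist v ∸ dist x) v
        same-level : ∀ {a b} → a ≤ suc b → b ≤ suc a → parity a ≡ parity b → a ≡ b
        same-level {a} {b} a≤ b≤ eq with ℕ.m≤n⇒m<n∨m≡n a≤ | ℕ.m≤n⇒m<n∨m≡n b≤
        ... | inj₂ refl | _         = ⊥-elim (Bool.not-¬ refl (sym eq))
        ... | inj₁ _    | inj₂ refl = ⊥-elim (Bool.not-¬ refl eq)
        ... | inj₁ a<   | inj₁ b<   = ℕ.≤-antisym (s≤s⁻¹ a<) (s≤s⁻¹ b<)

  -- One round: splitting off a tree and extending the colouring.

  -- R is the set of vertices still to be coloured.
  Settled : (V → Set) → Tree → Set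
  Settled R P = (∀ {x} → P ∋ x → ¬ R x) × (∀ {y} → R y → Att P y → SeesBoth P y)

  -- Odd adjacency is demanded only of trees attached to a common component of `R`: just these can
  -- end up in one clique.
  Compatible : (V → Set) → Tree → Tree → Set
  Compatible R P Q = Disjoint P Q ×
    (∀ {x y} → R x → Star (Edge R) x y → Att P x → Att Q y → OddAdj P Q)

  Edge-mono : ∀ {R R′ : V → Set} → (∀ {x} → R′ x → R x) → ∀ {x y} → Edge R′ x y → Edge R x y
  Edge-mono sub (x∈ , x~y , y∈) = sub x∈ , x~y , sub y∈

  Settled-anti : ∀ {R R′ : V → Set} {P} → (∀ {x} → R′ x → R x) → Settled R P → Settled R′ P
  Settled-anti sub (out , sees) = (λ x∈ x∈R′ → out x∈ (sub x∈R′)) , λ y∈ → sees (sub y∈)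

  -- A walk in the smaller set is a walk in the larger one, so shrinking `R` can only separate
  -- trees.
  Compatible-anti : ∀ {P Q} {R R′ : V → Set} → (∀ {x} → R′ x → R x) →
    Compatible R P Q → Compatible R′ P Q
  Compatible-anti sub (disj , odd) = disj , λ x∈ w → odd (sub x∈) (Star.map (Edge-mono sub) w)

  module _ {k : ℕ} where

    -- The pair is a class and a colour within a tree. The last condition keeps vertices of `R` off
    -- the classes of the earlier trees they touch, so that no conflict arises between a tree and
    -- what is coloured later.
    Colouring : (V → Set) → List (Tree × Fin k) → Set₁
    Colouring R ps = ∃ λ (α : V → Fin k × Bool) →
      (∀ {x} → R x → ∃ λ M → length M ≤ k × (∀ {u} → R u → x ~ u → α u ≡ α x → u ∈ M)) ×
      All (λ (P , c) → ∀ {x} → R x → Att P x → proj₁ (α x) ≢ c) ps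

    module Round (R : V → Set) (R? : Decidable R) (r : V) (r∈R : R r) (ps : List (Tree × Fin k))
      (settled : All (Settled R ∘ proj₁) ps)
      (compatible : AllPairs (λ p q → Compatible R (proj₁ p) (proj₁ q)) ps) where

      open Component R R? r r∈R

      Meets : Tree → Set
      Meets P = ∃ λ v → C v × Att P v

      meets? : ∀ P → Dec (Meets P)
      meets? P = Fin.any? λ v → C? v ×-dec att? P v

      terminal : Tree → V
      terminal P with meets? P
      ... | yes (v , _) = v
      -- A default inside `C`, so that `terminal-C` holds for every tree.
      ... | no _        = r

      terminal-C : ∀ P → C (terminal P)
      terminal-C P with meets? P
      ... | yes (_ , v∈ , _) = v∈
      ... | no _             = ε

      terminal-att : ∀ {P} → Meets P → Att P (terminal P)
      terminal-att {P} m with meets? P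
      ... | yes (_ , _ , a) = a
      ... | no ¬m           = ⊥-elim (¬m m)

      K : List (Tree × Fin k)
      K = filter (meets? ∘ proj₁) ps

      terminals : List V
      terminals = r ∷ map (terminal ∘ proj₁) K

      terminals⊆C : ∀ {v} → v ∈ terminals → C v
      terminals⊆C (here refl) = ε
      terminals⊆C (there v∈)  = All.lookup {P = C} (All.map⁺ (All.universal (terminal-C ∘ proj₁) K)) v∈

      open Hull terminals (here refl) terminals⊆C

      abstract
        grown : ∃ λ T → (∀ {x} → hull ∋ x → T ∋ x) × (∀ {x} → T ∋ x → C x) ×
          Defect (length terminals) T × Maximal C T
        grown = grow C? hull proj₁ hull-defect _ (allFin (n G)) refl λ _ _ → ∈-allFin _

      T : Tree
      T = proj₁ grown

      T⊆C : ∀ {x} → T ∋ x → C x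
      T⊆C = proj₁ (proj₂ (proj₂ grown))

      T-defect : Defect (length terminals) T
      T-defect = proj₁ (proj₂ (proj₂ (proj₂ grown)))

      T-maximal : Maximal C T
      T-maximal = proj₂ (proj₂ (proj₂ (proj₂ grown)))

      r∈T : T ∋ r
      r∈T = proj₁ (proj₂ grown) (L⊆hull (here refl))

      -- The terminal of the earlier tree lies in `T`, and as a vertex of `R` attached to a settled
      -- tree it sees both colours of that tree, among them its own colour in `T`.
      oddAdj-T : ∀ {p} → p ∈ ps → Meets (proj₁ p) → OddAdj T (proj₁ p)
      oddAdj-T {P , c} p∈ m with proj₂ (All.lookup settled p∈) (C⊆R (terminal-C P))
                                   (terminal-att m) (col T (terminal P))
      ... | x , x∈ , x~v , eq = _ , x , proj₁ (proj₂ grown) (L⊆hull (there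
              (∈-map⁺ (terminal ∘ proj₁) (∈-filter⁺ (meets? ∘ proj₁) p∈ m)))) , x∈ , ~-sym x~v , sym eq

      T-disjoint : ∀ {p} → p ∈ ps → Disjoint T (proj₁ p)
      T-disjoint p∈ x∈T x∈P = proj₁ (All.lookup settled p∈) x∈P (C⊆R (T⊆C x∈T))

      -- All trees of `K` touch the connected set `C`, so a walk from one contact vertex through `r`
      -- to another makes `Compatible` applicable.
      T∷K-clique : ∀ c → AllPairs
        (λ p q → Disjoint (proj₁ p) (proj₁ q) × OddAdj (proj₁ p) (proj₁ q)) ((T , c) ∷ K)
      T∷K-clique c =
        All.tabulate (λ p∈K → let p∈ , m = ∈-filter⁻ (meets? ∘ proj₁) p∈K in
          T-disjoint p∈ , oddAdj-T p∈ m) ∷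
        AllPairs-map-with-All
          (λ { (v , v∈ , a) (w , w∈ , b) (disj , odd) →
            disj , odd (C⊆R v∈) (Star.reverse Step-sym v∈ ◅◅ w∈) a b })
          (All.all-filter (meets? ∘ proj₁) ps)
          (AllPairs.filter⁺ (meets? ∘ proj₁) compatible)

      -- Otherwise the first `suc k` entries of `T` followed by `K` would form an odd clique minor.
      K-small : Fin k → ¬ OddMinor (complete (suc k)) G → length K < k
      K-small c noMinor = ℕ.≰⇒> λ k≤ → noMinor (oddMinor
        (λ i → proj₁ (lookup ((T , c) ∷ K) (inject≤ i (s≤s k≤))))
        (λ i≢j → proj₁ (clique k≤ i≢j)) (λ i≢j → proj₂ (clique k≤ i≢j)))
        where
        clique : (k≤ : k ≤ length K) → ∀ {i j} → i ≢ j → _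
        clique k≤ {i} {j} i≢j = AllPairs-lookup (T∷K-clique c)
          (λ {p} {q} (disj , odd) → (λ x∈q x∈p → disj x∈p x∈q) , OddAdj-sym {proj₁ p} {proj₁ q} odd)
          (inject≤ i (s≤s k≤)) (inject≤ j (s≤s k≤)) (i≢j ∘ Fin.inject≤-injective _ _ i j)

      R′ : V → Set
      R′ x = R x × ¬ T ∋ x

      R′? : Decidable R′
      R′? x = R? x ×-dec ¬? (T ∋? x)

      att-C : ∀ {y} → R y → Att T y → C y
      att-C y∈ (x , x∈ , x~y) = C-closed (T⊆C x∈) x~y y∈

      settled′ : ∀ c → All (Settled R′ ∘ proj₁) ((T , c) ∷ ps)
      settled′ c = ((λ x∈ (_ , x∉) → x∉ x∈) , λ (y∈ , y∉) a → T-maximal (att-C y∈ a) y∉ a) ∷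
        All.map (λ {p} → Settled-anti {P = proj₁ p} proj₁) settled

      -- A vertex of `R′` attached to `T` lies in `C`, and walks in `R′` do not leave `C`. An
      -- earlier tree attached to the end of such a walk therefore meets `C`, and `oddAdj-T`
      -- applies.
      compatible′ : ∀ c → AllPairs (λ p q → Compatible R′ (proj₁ p) (proj₁ q)) ((T , c) ∷ ps)
      compatible′ c =
        All.tabulate (λ p∈ → T-disjoint p∈ , λ (x∈ , _) w a b →
          oddAdj-T p∈ (_ , att-C x∈ a ◅◅ Star.map (Edge-mono proj₁) w , b)) ∷
        AllPairs.map (λ {p} {q} → Compatible-anti {proj₁ p} {proj₁ q} proj₁) compatible

      -- `T` takes class `c`, the rest keeps `α′`. Vertices of `R′` adjacent to `T` avoid `c`, so no
      -- monochromatic edge joins them to `T` and the two defect bounds do not add up.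
      combine-colourings : length K < k → ∀ {c} → c ∉ map proj₂ K →
        Colouring R′ ((T , c) ∷ ps) → Colouring R ps
      combine-colourings small {c} c∉ (α′ , defect′ , avoidT ∷ avoid) = α , defect , All.tabulate avoid-ps
        where
        paint : ∀ x → Dec (T ∋ x) → Fin k × Bool
        paint x (yes _) = c , col T x
        paint x (no _)  = α′ x
        α : V → Fin k × Bool
        α x = paint x (T ∋? x)

        defect : ∀ {x} → R x → ∃ λ M → length M ≤ k × (∀ {u} → R u → x ~ u → α u ≡ α x → u ∈ M)
        defect {x} x∈ with T ∋? x
        -- `T` has defect `suc (length K)`, one for `r` and one for each tree of `K`; this is at
        -- most `k`.
        ... | yes x∈T = let M , short , cover = T-defect x∈T in
            M , ℕ.≤-trans short (subst (_< k) (sym (length-map _ K)) small) , covers M cover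
          where
          covers : ∀ M → (∀ {u} → Mono T x u → u ∈ M) → ∀ {u} → R u → x ~ u → α u ≡ (c , col T x) → u ∈ M
          covers M cover {u} u∈ x~u eq with T ∋? u
          ... | yes u∈T = cover (u∈T , x~u , cong proj₂ eq)
          ... | no u∉T  = ⊥-elim (avoidT (u∈ , u∉T) (x , x∈T , x~u) (cong proj₁ eq))
        ... | no x∉T = let M , short , cover = defect′ (x∈ , x∉T) in M , short , covers M cover
          where
          covers : ∀ M → (∀ {u} → R′ u → x ~ u → α′ u ≡ α′ x → u ∈ M) →
            ∀ {u} → R u → x ~ u → α u ≡ α′ x → u ∈ M
          covers M cover {u} u∈ x~u eq with T ∋? u
          ... | yes u∈T = ⊥-elim (avoidT (x∈ , x∉T) (u , u∈T , ~-sym x~u) (cong proj₁ (sym eq)))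
          ... | no u∉T  = cover (u∈ , u∉T) x~u eq

        avoid-ps : ∀ {p} → p ∈ ps → ∀ {x} → R x → Att (proj₁ p) x → proj₁ (α x) ≢ proj₂ p
        avoid-ps p∈ {x} x∈ a with T ∋? x
        -- A tree attached to a vertex of `T` meets `C` and so belongs to `K`, whose classes exclude
        -- `c`.
        ... | yes x∈T = λ { refl → c∉ (∈-map⁺ proj₂ (∈-filter⁺ (meets? ∘ proj₁) p∈ (x , T⊆C x∈T , a))) }
        ... | no x∉T  = All.lookup avoid p∈ (x∈ , x∉T) a

    -- Each round removes at least `r` from `R`, so the list `L` covering `R` shrinks and the
    -- recursion on `l` ends.
    colouring : Fin k → ¬ OddMinor (complete (suc k)) G →
      ∀ l (L : List V) → length L ≡ l → ∀ R → Decidable R → (∀ {x} → R x → x ∈ L) →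
      ∀ ps → All (Settled R ∘ proj₁) ps →
      AllPairs (λ p q → Compatible R (proj₁ p) (proj₁ q)) ps → Colouring R ps
    colouring c₀ noMinor l L len R R? R⊆L ps settled compatible with Fin.any? R?
    ... | no none = (λ _ → c₀ , false) , (λ {x} x∈ → ⊥-elim (none (x , x∈))) ,
          All.universal (λ _ {x} x∈ → ⊥-elim (none (x , x∈))) ps
    ... | yes (r , r∈) with remove (R⊆L r∈)
    ...   | L′ , len′ , keep with l | trans (sym len) len′
    ...     | suc l′ | eq = combine-colourings small (proj₂ new)
                (colouring c₀ noMinor l′ L′ (sym (ℕ.suc-injective eq)) R′ R′?
                  (λ (x∈ , x∉T) → keep (R⊆L x∈) λ { refl → x∉T r∈T })
                  ((T , proj₁ new) ∷ ps) (settled′ _) (compatible′ _))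
      where
      open Round R R? r r∈ ps settled compatible
      small : length K < k
      small = K-small c₀ noMinor
      -- Only the trees meeting `C` restrict the choice; there are fewer than `k` of them, so a
      -- class is free.
      new : ∃ λ c → c ∉ map proj₂ K
      new = fresh (map proj₂ K) (subst (_< k) (sym (length-map proj₂ K)) small)

  -- The bound for the whole graph.

  colourable : ∀ k → ¬ OddMinor (complete (suc (suc k))) G → ∀ {N} → suc k * 2 ≤ N →
    DefectColourable G N (suc k)
  colourable k noMinor {N} le
    -- At the start all vertices are uncoloured and there are no earlier trees, so both invariants
    -- hold vacuously.
    with colouring zero noMinor _ (allFin (n G)) refl (λ _ → ⊤) (λ _ → yes tt) (λ _ → ∈-allFin _) [] [] []
  ... | α , defect , _ = β , bound
    where
    β : V → Fin N
    β x = inject≤ (pairIndex (α x)) le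
    β-reflects : ∀ u v → β u ≡ β v → α u ≡ α v
    β-reflects u v eq = pairIndex-injective (α u) (α v) (Fin.inject≤-injective le le _ _ eq)
    bound : ∀ v → sameColourDegree G β v ≤ suc k
    bound v with defect {v} tt
    -- The filtered list has no repetitions and lies inside `M`.
    ... | M , short , cover = ℕ.≤-trans (unique-⊆⇒length≤
            (Unique.filter⁺ (T? ∘ same) (Unique.allFin⁺ (n G)))
            λ {u} u∈ →
              let v~u , eq = same⇒ u (proj₂ (∈-filter⁻ (T? ∘ same) {xs = allFin (n G)} u∈))
              in cover tt v~u eq) short
      where
      same : V → Bool
      same u = adj G v u ∧ ⌊ β u ≟ β v ⌋
      same⇒ : ∀ u → Bool.T (same u) → v ~ u × α u ≡ α v
      same⇒ u t with adj G v u | β u ≟ β v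
      ... | true | yes eq = refl , β-reflects u v eq

theorem1p9 : ∀ (t : ℕ) → 2 ≤ t → ∃ λ (d : ℕ) →
    ∀ (G : Graph) → ¬ OddMinor (complete t) G → DefectColourable G (6 * t ∸ 9) d
-- With `t` equal to `k + 2` there are `k + 1` classes, and `k + 1` is also the defect.
theorem1p9 (suc (suc k)) _ = suc k , λ G noMinor → colourable G k noMinor enough
  where
  enough : suc k * 2 ≤ 6 * suc (suc k) ∸ 9
  -- The slack between `2(t - 1)` and `6t - 9` is `4k + 1`.
  enough = ℕ.m+n≤o⇒m≤o∸n (suc k * 2) (subst (suc k * 2 + 9 ≤_)
    (solve 1 (λ m → (con 1 :+ m) :* con 2 :+ con 9 :+ (con 4 :* m :+ con 1) := con 6 :* (con 2 :+ m)) refl k)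
    (ℕ.m≤m+n (suc k * 2 + 9) (4 * k + 1)))
    where open +-*-Solver
theorem1p9 1 (s≤s ())
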